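{- Let $\beta$ be a $\mathsf{TLCGA}$-bisimulation in a concurrent game model $\mathcal M$. Then for every $\mathsf{TLCGA}$-formula (state formula) $\varphi$ and every pair of states $s_1,s_2$ of $\mathcal M$ such that $s_1\,\beta\,s_2$: $\mathcal M,s_1\Vdash\varphi$ if and only if $\mathcal M,s_2\Vdash\varphi$.
   Context: **Models.** Fix a finite set $\mathsf{Agt}$ of agents and a set $\mathsf{AP}$ of atomic propositions; a coalition is any subset of $\mathsf{Agt}$. A game form over an outcome set $O$ is $(\mathsf{Act},\mathsf{act},O,\mathsf{out})$ with $\mathsf{Act}\ne\emptyset$, $\mathsf{act}$ assigning to each agent $a$ a non-empty set $\mathsf{act}_a\subseteq\mathsf{Act}$, and $\mathsf{out}:\prod_{a\in\mathsf{Agt}}\mathsf{act}_a\to O$. A concurrent game model is $\mathcal M=(S,\mathsf{Act},\mathfrak g,V)$ with $S\neq\emptyset$ a set of states, $\mathfrak g$ assigning to each $w\in S$ a game form $(\mathsf{Act},\mathsf{act}_w,S,\mathsf{out}_w)$ over $S$, and $V:\mathsf{AP}\to\mathcal P(S)$. An action profile at $w$ is an element of $\prod_a\mathsf{act}_w(a)$. A history is a finite word $w_0\zeta_0w_1\cdots\zeta_{n-1}w_n$ ($n\ge 0$) with $w_i\in S$ and $\zeta_i$ an action profile at $w_i$. A strategy for $a$ maps each history ending in $w$ to an element of $\mathsf{act}_w(a)$; a strategy profile $\Sigma$ assigns a strategy to each agent. The play induced by $\Sigma$ at $w$ is $w_0\zeta_0w_1\zeta_1\cdots$ with $w_0=w$,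 $\zeta_n=\Sigma(w_0\zeta_0\cdots w_n)$, $w_{n+1}=\mathsf{out}_{w_n}(\zeta_n)$; its path is $w_0w_1w_2\cdots$. $\mathsf{paths}(w,\Sigma,C)$ is the set of paths of plays induced at $w$ by strategy profiles $\Sigma'$ that agree with $\Sigma$ on all agents in $C$. **Language $\mathsf{TLCGA}$.** State formulas: $\varphi::=p\mid\top\mid\neg\varphi\mid(\varphi\wedge\varphi)\mid(\varphi\vee\varphi)\mid\langle\![\gamma]\!\rangle$; path formulas: $\theta::=\mathsf X\varphi\mid\varphi\,\mathsf U\,\varphi\mid\mathsf G\varphi$; here $p\in\mathsf{AP}$ and $\gamma$ is a goal assignment, i.e. a map from $\mathcal P(\mathsf{Agt})$ to path formulas. **Semantics.** Booleans as usual. For a path $\pi=w_0w_1\cdots$: $\pi\Vdash\mathsf X\varphi$ iff $\varphi$ is true at $w_1$; $\pi\Vdash\varphi\,\mathsf U\,\psi$ iff for some $i$, $\psi$ is true at $w_i$ and $\varphi$ at all $w_j$, $j<i$; $\pi\Vdash\mathsf G\varphi$ iff $\varphi$ is true at all $w_i$. $\mathcal M,s\Vdash\langle\![\gamma]\!\rangle$ iff there is a strategy profile $\Sigma$ such that for every $C\subseteq\mathsf{Agt}$ and every $\pi\in\mathsf{paths}(s,\Sigma,C)$, $\pi\Vdash\gamma(C)$. **Bisimulation.** For an action profile $\zeta$ at $w$ and a coalition $C$, $\mathsf{Out}[w,\zeta|_C]$ is the set of states $\mathsf{out}_w(\zeta')$ for action profiles $\zeta'$ at $w$ that agree with $\zeta$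 on $C$. A relation $\beta\subseteq S^2$ is a $\mathsf{TLCGA}$-bisimulation in $\mathcal M$ if whenever $s_1\beta s_2$: (Atom equivalence) for all $p\in\mathsf{AP}$, $s_1\in V(p)$ iff $s_2\in V(p)$; (Forth) for every action profile $\zeta^1$ at $s_1$ there is an action profile $\zeta^2$ at $s_2$ such that for every coalition $C$ and every $u_2\in\mathsf{Out}[s_2,\zeta^2|_C]$ there is $u_1\in\mathsf{Out}[s_1,\zeta^1|_C]$ with $u_1\beta u_2$; (Back) for every action profile $\zeta^2$ at $s_2$ there is an action profile $\zeta^1$ at $s_1$ such that for every coalition $C$ and every $u_1\in\mathsf{Out}[s_1,\zeta^1|_C]$ there is $u_2\in\mathsf{Out}[s_2,\zeta^2|_C]$ with $u_1\beta u_2$. -}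

module Defs where

open import Data.Fin using (Fin)
open import Data.Fin.Subset using (Subset; _∈_)
open import Data.Irrelevant as Irr using (Irrelevant)
open import Data.Fin.Properties using (sequence)
open import Data.Nat using (ℕ; zero; suc; _<_)
open import Data.Product using (∃; ∃-syntax; _×_; _,_; proj₁; proj₂)
open import Data.Refinement using (Refinement; Refinement-syntax; value; proof; _,_)
open import Data.Sum using (_⊎_)
open import Data.Unit.Polymorphic using (⊤)
open import Data.Vec using (Vec; lookup; tabulate)
open import Data.Vec.Properties using (lookup∘tabulate)
open import Effect.Applicative using (RawApplicative; mkRawApplicative)
open import Function.Bundles using (_⇔_)
open import Level using (Level) renaming (suc to lsuc)
open import Relation.Binary.Core using (Rel)
open import Relation.Binary.PropositionalEquality using (_≡_; sym; subst)
open import Relation.Nullary using (¬_)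
open import Relation.Unary using (Pred; Satisfiable)

-- The finite set of agents is Fin n, and a coalition is a Subset n.

-- The set-theoretic subset {x ∈ A | P x}, as a type: membership proofs are
-- irrelevant, so elements are equal as soon as their values are.
⟦_⟧ : ∀ {ℓ} {A : Set ℓ} → Pred A ℓ → Set ℓ
⟦ P ⟧ = [ x ∈ _ ∣ P x ]

record GameForm {ℓ : Level} (n : ℕ) (Act : Set ℓ) (O : Set ℓ) : Set (lsuc ℓ) where
  field
    Act-nonempty : Act
    act          : Fin n → Pred Act ℓ
    act-nonempty : ∀ a → Satisfiable (act a)

  -- The product ∏ₐ act a.  Tuples are vectors rather than functions on Fin n
  -- so that, as in set theory, componentwise equal tuples are equal.
  Profile : Set ℓ
  Profile = [ ζ ∈ Vec Act n ∣ (∀ a → act a (lookup ζ a)) ]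

  field
    out : Profile → O

  _‼_ : Profile → Fin n → Act
  ζ ‼ a = lookup (value ζ) a

  tuple : (∀ a → ⟦ act a ⟧) → Profile
  tuple f = tabulate (λ a → value (f a)) , members
    where
    irrelevantApplicative : RawApplicative {ℓ} Irrelevant
    irrelevantApplicative = mkRawApplicative Irrelevant Irr.pure Irr._<*>_

    members : Irrelevant (∀ a → act a (lookup (tabulate (λ b → value (f b))) a))
    members = sequence irrelevantApplicative λ a →
      Irr.map (subst (act a) (sym (lookup∘tabulate (λ b → value (f b)) a))) (proof (f a))

  Out[_∣_] : Profile → Subset n → Pred O ℓ
  Out[ ζ ∣ C ] u = ∃[ ζ′ ] (∀ a → a ∈ C → (ζ′ ‼ a) ≡ (ζ ‼ a)) × out ζ′ ≡ u

record ConcurrentGameModel {ℓ : Level} (n : ℕ) (AP : Set ℓ) : Set (lsuc ℓ) where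
  field
    S          : Set ℓ
    S-nonempty : S
    Act        : Set ℓ
    𝔤          : S → GameForm n Act S
    V          : AP → Pred S ℓ

  module 𝔤 (w : S) = GameForm (𝔤 w)

module _ {ℓ : Level} (n : ℕ) (AP : Set ℓ) where

  infixr 6 _∧′_
  infixr 5 _∨′_

  mutual
    data Formula : Set ℓ where
      atom : AP → Formula
      ⊤′   : Formula
      ¬′_  : Formula → Formula
      _∧′_ : Formula → Formula → Formula
      _∨′_ : Formula → Formula → Formula
      ⟨[_]⟩ : (Subset n → PathFormula) → Formula

    data PathFormula : Set ℓ where
      X_  : Formula → PathFormula
      _U_ : Formula → Formula → PathFormula
      G_  : Formula → PathFormula

module Strategies {ℓ : Level} {n : ℕ} {AP : Set ℓ} (M : ConcurrentGameModel n AP) where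
  open ConcurrentGameModel M

  -- Histories, indexed by their last state.  A successor state need not be the
  -- outcome of the preceding profile.
  data History : S → Set ℓ where
    start    : ∀ w → History w
    _▷⟨_⟩_ : ∀ {w} → History w → 𝔤.Profile w → ∀ w′ → History w′

  Strategy : Fin n → Set ℓ
  Strategy a = ∀ {w} → History w → ⟦ 𝔤.act w a ⟧

  StrategyProfile : Set ℓ
  StrategyProfile = ∀ a → Strategy a

  _at_ : StrategyProfile → ∀ {w} → History w → 𝔤.Profile w
  Σ at h = 𝔤.tuple _ (λ a → Σ a h)

  -- The prefix of the play induced by Σ at w that ends in its i-th state,
  -- paired with that state.
  play : StrategyProfile → S → ℕ → ∃ History
  play Σ w zero    = w , start w
  play Σ w (suc i) =
    let (u , h) = play Σ w i
        u′      = 𝔤.out u (Σ at h)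
    in u′ , (h ▷⟨ Σ at h ⟩ u′)

  path : StrategyProfile → S → ℕ → S
  path Σ w i = proj₁ (play Σ w i)

  -- Strategies and paths are compared pointwise, which is what equality of
  -- functions means set-theoretically.
  Agree : Subset n → StrategyProfile → StrategyProfile → Set ℓ
  Agree C Σ Σ′ = ∀ a → a ∈ C → ∀ {w} (h : History w) → Σ a h ≡ Σ′ a h

  paths : S → StrategyProfile → Subset n → Pred (ℕ → S) ℓ
  paths w Σ C π = ∃[ Σ′ ] Agree C Σ Σ′ × (∀ i → π i ≡ path Σ′ w i)

module Semantics {ℓ : Level} {n : ℕ} {AP : Set ℓ} (M : ConcurrentGameModel n AP) where
  open ConcurrentGameModel M
  open Strategies M

  infix 4 _⊩_ _⊩ᵖ_

  mutual
    _⊩_ : S → Formula n AP → Set ℓ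
    s ⊩ atom p   = V p s
    s ⊩ ⊤′       = ⊤
    s ⊩ ¬′ φ     = ¬ (s ⊩ φ)
    s ⊩ φ ∧′ ψ   = (s ⊩ φ) × (s ⊩ ψ)
    s ⊩ φ ∨′ ψ   = (s ⊩ φ) ⊎ (s ⊩ ψ)
    s ⊩ ⟨[ γ ]⟩  = ∃[ Σ ] (∀ C π → paths s Σ C π → π ⊩ᵖ γ C)

    _⊩ᵖ_ : (ℕ → S) → PathFormula n AP → Set ℓ
    π ⊩ᵖ X φ     = π 1 ⊩ φ
    π ⊩ᵖ (φ U ψ) = ∃[ i ] (π i ⊩ ψ) × (∀ j → j < i → π j ⊩ φ)
    π ⊩ᵖ G φ     = ∀ i → π i ⊩ φ

module _ {ℓ : Level} {n : ℕ} {AP : Set ℓ} (M : ConcurrentGameModel n AP) where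
  open ConcurrentGameModel M

  record IsBisimulation (β : Rel S ℓ) : Set ℓ where
    field
      atoms : ∀ {s₁ s₂} → β s₁ s₂ → ∀ p → V p s₁ ⇔ V p s₂
      forth : ∀ {s₁ s₂} → β s₁ s₂ → ∀ ζ¹ → ∃[ ζ² ] ∀ C u₂ →
              𝔤.Out[_∣_] s₂ ζ² C u₂ → ∃[ u₁ ] 𝔤.Out[_∣_] s₁ ζ¹ C u₁ × β u₁ u₂
      back  : ∀ {s₁ s₂} → β s₁ s₂ → ∀ ζ² → ∃[ ζ¹ ] ∀ C u₁ →
              𝔤.Out[_∣_] s₁ ζ¹ C u₁ → ∃[ u₂ ] 𝔤.Out[_∣_] s₂ ζ² C u₂ × β u₁ u₂

{-# OPTIONS --safe #-}
module Submission where

-- A witness Σ for ⟨[γ]⟩ at s₁ is turned into one at s₂ by running, along each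
-- history h at s₂, a mirror history at s₁ that ends in a β-related state: the
-- new strategy answers h by the Forth response to Σ's profile at the mirror of h.
-- When the profile ζ actually played deviates from that response, the mirror
-- moves by a profile that keeps Σ's actions for all agents that did not deviate.
-- The mirror does not depend on any coalition in advance, since a play of C is
-- also followed by every agent in C: the set of non-deviating agents contains C
-- at each step.  The mirror of a play of C at s₂ is therefore a play of C at s₁.

open import Defs
open import Axiom.ExcludedMiddle using (ExcludedMiddle)
open import Data.Bool using (true)
open import Data.Fin using (Fin)
open import Data.Fin.Subset using (Subset; _∈_)
open import Data.Irrelevant as Irr using ([_])
open import Data.Maybe as Maybe using (Maybe; just; maybe′)
open import Data.Nat using (ℕ; zero; suc)
open import Data.Product using (∃; ∃-syntax; _×_; _,_; proj₁; proj₂)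
open import Data.Refinement using (value; proof; _,_; value-injective)
open import Data.Sum using (inj₁; inj₂)
open import Data.Vec using (tabulate)
open import Data.Vec.Properties
  using (lookup∘tabulate; tabulate∘lookup; tabulate-cong; []=⇒lookup; lookup⇒[]=)
open import Function.Base using (flip)
open import Function.Bundles using (_⇔_; mk⇔; Equivalence)
open import Level using (Level)
open import Relation.Binary.Core using (Rel)
open import Relation.Binary.PropositionalEquality
  using (_≡_; refl; sym; trans; cong; subst; module ≡-Reasoning)
open import Relation.Nullary using (Dec; does; yes; no; contradiction)
open import Relation.Nullary.Decidable using (dec-true; dec⇒maybe)

does⇒ : ∀ {ℓ} {P : Set ℓ} (P? : Dec P) → does P? ≡ true → P
does⇒ (yes p) _ = p

dec⇒maybe-just : ∀ {ℓ} {P : Set ℓ} (P? : Dec P) → P → ∃[ p ] dec⇒maybe P? ≡ just p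
dec⇒maybe-just (yes p) _  = p , refl
dec⇒maybe-just (no ¬p) p = contradiction p ¬p

module _ {ℓ} {n : ℕ} {Act O : Set ℓ} (F : GameForm n Act O) where
  open GameForm F

  component : Profile → ∀ a → ⟦ act a ⟧
  component ζ a = (ζ ‼ a) , Irr.map (λ member → member a) (proof ζ)

  tuple-unique : ∀ f ζ → (∀ a → f a ≡ component ζ a) → tuple f ≡ ζ
  tuple-unique f ζ f≗ζ = value-injective
    (trans (tabulate-cong (λ a → cong value (f≗ζ a))) (tabulate∘lookup (value ζ)))

module _ {ℓ : Level} {n : ℕ} {AP : Set ℓ} (em : ExcludedMiddle ℓ)
         (M : ConcurrentGameModel n AP) where
  open ConcurrentGameModel M
  open Strategies M
  open Semantics M

  infix 30 _‼_
  _‼_ : ∀ {w} → 𝔤.Profile w → Fin n → Act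
  _‼_ {w} = 𝔤._‼_ w

  at-‼ : ∀ σ {w} (h : History w) a → (σ at h) ‼ a ≡ value (σ a h)
  at-‼ σ h a = lookup∘tabulate (λ b → value (σ b h)) a

  _▸_ : (x : ∃ History) → 𝔤.Profile (proj₁ x) → ∃ History
  (w , h) ▸ ζ = 𝔤.out w ζ , (h ▷⟨ ζ ⟩ 𝔤.out w ζ)

  length : ∀ {w} → History w → ℕ
  length (start _)       = zero
  length (h ▷⟨ _ ⟩ _) = suc (length h)

  -- A play of C under σ, given as a sequence of histories, is induced by the
  -- strategy profile that follows the sequence wherever possible and σ elsewhere.
  module Realise (σ : StrategyProfile) (C : Subset n) (s : S)
    (k : ℕ → ∃ History) (ζ : ∀ i → 𝔤.Profile (proj₁ (k i)))
    (k-zero : k zero ≡ (s , start s)) (k-suc : ∀ i → k (suc i) ≡ k i ▸ ζ i)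
    (agrees : ∀ i a → a ∈ C → ζ i ‼ a ≡ (σ at proj₂ (k i)) ‼ a) where

    -- A history can thus occur in the sequence only at the index given by its length, so `realised`
    -- has a single index to test.
    length-k : ∀ i → length (proj₂ (k i)) ≡ i
    length-k zero    rewrite k-zero  = refl
    length-k (suc i) rewrite k-suc i = cong suc (length-k i)

    -- The history, the index and the decision are separate arguments so that the lemmas below can
    -- match on the equation; `realised` supplies `em`.
    choose : ∀ a (x : ∃ History) j → Dec (k j ≡ x) → ⟦ 𝔤.act (proj₁ x) a ⟧
    choose a x j (yes eq) =
      subst (λ y → ⟦ 𝔤.act (proj₁ y) a ⟧) eq (component (𝔤 _) (ζ j) a)
    choose a x j (no _)   = σ a (proj₂ x)

    realised : StrategyProfile
    realised a h = choose a (_ , h) (length h) em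

    choose-k : ∀ a {i j} → j ≡ i → (d : Dec (k j ≡ k i)) →
      choose a (k i) j d ≡ component (𝔤 _) (ζ i) a
    choose-k a refl (yes refl) = refl
    choose-k a refl (no ¬eq)   = contradiction refl ¬eq

    choose-agrees : ∀ {a} → a ∈ C → ∀ x j d → σ a (proj₂ x) ≡ choose a x j d
    choose-agrees {a} a∈C x j (yes refl) = value-injective
      (sym (trans (agrees j a a∈C) (at-‼ σ (proj₂ (k j)) a)))
    choose-agrees     a∈C x j (no _)     = refl

    realised-agrees : Agree C σ realised
    realised-agrees a a∈C h = choose-agrees a∈C (_ , h) (length h) em

    realised-at : ∀ i → realised at proj₂ (k i) ≡ ζ i
    realised-at i = tuple-unique (𝔤 _) _ (ζ i) (λ a → choose-k a (length-k i) em)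

    realised-play : ∀ i → play realised s i ≡ k i
    realised-play zero    = sym k-zero
    realised-play (suc i) = begin
      play realised s i ▸ (realised at proj₂ (play realised s i))
        ≡⟨ cong (λ x → x ▸ (realised at proj₂ x)) (realised-play i) ⟩
      k i ▸ (realised at proj₂ (k i))
        ≡⟨ cong (k i ▸_) (realised-at i) ⟩
      k i ▸ ζ i
        ≡⟨ k-suc i ⟨
      k (suc i) ∎
      where open ≡-Reasoning

  IsBisimulation-flip : ∀ {β} → IsBisimulation M β → IsBisimulation M (flip β)
  IsBisimulation-flip bisim = record
    { atoms = λ b p → mk⇔ (Equivalence.from (atoms b p)) (Equivalence.to (atoms b p))
    ; forth = back
    ; back  = forth
    }
    where open IsBisimulation bisim

  module Mirror {β : Rel S ℓ} (bisim : IsBisimulation M β)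
                (σ : StrategyProfile) (s₁ : S) where
    open IsBisimulation bisim

    Match : S → Set ℓ
    Match w = ∃[ u ] History u × β u w

    history : ∀ {w} → Match w → ∃ History
    history (u , h , _) = u , h

    planned : ∀ {w} (m : Match w) → 𝔤.Profile (proj₁ m)
    planned (_ , h , _) = σ at h

    response : ∀ {w} → Match w → 𝔤.Profile w
    response m@(_ , _ , b) = proj₁ (forth b (planned m))

    -- The target `w′` need not be `𝔤.out w ζ`, since a history may record any successor; in that
    -- case an answer may fail to exist.
    Answer : ∀ {w} → Match w → 𝔤.Profile w → S → Set ℓ
    Answer m ζ w′ = ∃[ ζ′ ] (∀ a → ζ ‼ a ≡ response m ‼ a → ζ′ ‼ a ≡ planned m ‼ a)
                            × β (𝔤.out (proj₁ m) ζ′) w′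

    -- Forth is used for the coalition `D` of all agents that obey the response; `ζ` itself
    -- witnesses that its outcome is reachable when `D` is fixed.
    answer : ∀ {w} (m : Match w) ζ → Answer m ζ (𝔤.out w ζ)
    answer {w} m@(_ , _ , b) ζ =
      let (_ , (ζ′ , keeps , eq) , b′) = proj₂ (forth b (planned m)) D _ (ζ , ∈D⇒ , refl)
      in ζ′ , (λ a obeys → keeps a (⇒∈D a obeys)) , subst (flip β _) (sym eq) b′
      where
      obeys? : ∀ a → Dec (ζ ‼ a ≡ response m ‼ a)
      obeys? _ = em

      D : Subset n
      D = tabulate (λ a → does (obeys? a))

      ∈D⇒ : ∀ a → a ∈ D → ζ ‼ a ≡ response m ‼ a
      ∈D⇒ a a∈D = does⇒ (obeys? a) (trans (sym (lookup∘tabulate _ a)) ([]=⇒lookup a∈D))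

      ⇒∈D : ∀ a → ζ ‼ a ≡ response m ‼ a → a ∈ D
      ⇒∈D a eq = lookup⇒[]= a D (trans (lookup∘tabulate _ a) (dec-true (obeys? a) eq))

    advance : ∀ {w} (m : Match w) ζ {w′} → Answer m ζ w′ → Match w′
    advance m _ (ζ′ , _ , b) = let (u , h) = history m ▸ ζ′ in u , h , b

    -- Partial, because a history may start in a state unrelated to `s₁` or contain a step without
    -- an answer. Taking the answers from `em` makes the mirror a function of the history alone.
    mirror : ∀ {w} → History w → Maybe (Match w)
    mirror (start w)       = Maybe.map (λ b → s₁ , start s₁ , b) (dec⇒maybe em)
    mirror (h ▷⟨ ζ ⟩ w′) =
      mirror h Maybe.>>= λ m → Maybe.map (advance m ζ) (dec⇒maybe em)

    mirror-start : ∀ {w} → β s₁ w → ∃[ b ] mirror (start w) ≡ just (s₁ , start s₁ , b)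
    mirror-start b =
      let (b′ , eq) = dec⇒maybe-just em b in b′ , cong (Maybe.map _) eq

    mirror-▷ : ∀ {w} (h : History w) {m} → mirror h ≡ just m → ∀ ζ →
      ∃[ r ] mirror (h ▷⟨ ζ ⟩ 𝔤.out w ζ) ≡ just (advance m ζ r)
    mirror-▷ h {m} eq ζ rewrite eq =
      let (r , eq′) = dec⇒maybe-just em (answer m ζ) in r , cong (Maybe.map (advance m ζ)) eq′

    mirrored : StrategyProfile
    mirrored a {w} h =
      maybe′ (λ m → component (𝔤 w) (response m) a)
             -- Histories without a mirror never arise in the plays considered, so any available
             -- action will do.
             (let (x , member) = 𝔤.act-nonempty w a in x , [ member ])
             (mirror h)

    mirrored-obeys : ∀ {C τ} → Agree C mirrored τ → ∀ {w} (h : History w) {m} →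
      mirror h ≡ just m → ∀ a → a ∈ C → (τ at h) ‼ a ≡ response m ‼ a
    mirrored-obeys {τ = τ} agree h eq a a∈C =
      trans (at-‼ τ h a)
            (trans (cong value (sym (agree a a∈C h)))
                   (cong (λ x → value (maybe′ _ _ x)) eq))

    module _ {s₂} (b₀ : β s₁ s₂) {C τ} (agree : Agree C mirrored τ) where

      -- The play starts in a state related to `s₁` and moves only to actual outcomes, so `answer`
      -- applies at each step and the mirror never fails.
      tracked : ∀ i → ∃[ m ] mirror (proj₂ (play τ s₂ i)) ≡ just m

      moved : ∀ i → Answer (proj₁ (tracked i)) (τ at proj₂ (play τ s₂ i)) (path τ s₂ (suc i))

      tracked zero    = _ , proj₂ (mirror-start b₀)
      tracked (suc i) = _ , proj₂ (mirror-▷ (proj₂ (play τ s₂ i)) (proj₂ (tracked i)) _)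

      moved i = proj₁ (mirror-▷ (proj₂ (play τ s₂ i)) (proj₂ (tracked i)) _)

      open Realise σ C s₁ (λ i → history (proj₁ (tracked i))) (λ i → proj₁ (moved i))
        -- By definition, `tracked (suc i)` advances `tracked i` by the answer `moved i`.
        refl (λ _ → refl)
        -- Agents in `C` play the response under `τ`, so the answer keeps their planned actions.
        (λ i a a∈C → proj₁ (proj₂ (moved i)) a
          (mirrored-obeys agree (proj₂ (play τ s₂ i)) (proj₂ (tracked i)) a a∈C))

      mirror-path : ∃[ π ] paths s₁ σ C π × (∀ i → β (π i) (path τ s₂ i))
      mirror-path =
        (λ i → proj₁ (history (proj₁ (tracked i)))) ,
        (realised , realised-agrees , λ i → cong proj₁ (sym (realised-play i))) ,
        λ i → proj₂ (proj₂ (proj₁ (tracked i)))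

  transfer : ∀ {β} → IsBisimulation M β → ∀ φ {s₁ s₂} → β s₁ s₂ → s₁ ⊩ φ → s₂ ⊩ φ

  transferᵖ : ∀ {β} → IsBisimulation M β → ∀ θ {π₁ π₂} → (∀ i → β (π₁ i) (π₂ i)) →
    π₁ ⊩ᵖ θ → π₂ ⊩ᵖ θ

  transfer bisim (atom p)  b v        = Equivalence.to (IsBisimulation.atoms bisim b p) v
  transfer bisim ⊤′        b t        = t
  -- Negation reverses the direction, so the induction hypothesis is needed for the converse
  -- relation; hence `β` is quantified inside the induction.
  transfer bisim (¬′ φ)    b ¬v v     = ¬v (transfer (IsBisimulation-flip bisim) φ b v)
  transfer bisim (φ ∧′ ψ)  b (v , w)  = transfer bisim φ b v , transfer bisim ψ b w
  transfer bisim (φ ∨′ ψ)  b (inj₁ v) = inj₁ (transfer bisim φ b v)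
  transfer bisim (φ ∨′ ψ)  b (inj₂ w) = inj₂ (transfer bisim ψ b w)
  transfer {β} bisim ⟨[ γ ]⟩ {s₁} b (σ , wins) =
    mirrored , λ C π₂ (τ , agree , π₂≗τ) →
      let (π₁ , π₁∈paths , related) = mirror-path b agree
      in transferᵖ bisim (γ C) (λ i → subst (β (π₁ i)) (sym (π₂≗τ i)) (related i))
                   (wins C π₁ π₁∈paths)
    where open Mirror bisim σ s₁

  transferᵖ bisim (X φ)   b v               = transfer bisim φ (b 1) v
  transferᵖ bisim (φ U ψ) b (i , v , until) =
    i , transfer bisim ψ (b i) v , λ j j<i → transfer bisim φ (b j) (until j j<i)
  transferᵖ bisim (G φ)   b v i             = transfer bisim φ (b i) (v i)

theorem2 : ∀ {ℓ : Level} → ExcludedMiddle ℓ →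
    ∀ (n : ℕ) (AP : Set ℓ) (M : ConcurrentGameModel n AP)
    (β : Rel (ConcurrentGameModel.S M) ℓ) → IsBisimulation M β →
    ∀ (φ : Formula n AP) (s₁ s₂ : ConcurrentGameModel.S M) → β s₁ s₂ →
    let open Semantics M in (s₁ ⊩ φ) ⇔ (s₂ ⊩ φ)
theorem2 em n AP M β bisim φ s₁ s₂ b =
  mk⇔ (transfer em M bisim φ b) (transfer em M (IsBisimulation-flip em M bisim) φ b)
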